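{- Let $G$ be a triangle-free finite simple graph with maximum degree at most $3$. If $G$ is $2$-connected and $\mathrm{girth}(G)\le 6$, then $V(G)$ can be partitioned into at most $42$ admissible sets.
   Context: For a vertex $u$ and positive integer $i$, $N_G^i(u)=\{v\in V(G): v\ne u \text{ and there is a path of length } i \text{ in } G \text{ connecting } u \text{ and } v\}$. A set $X\subseteq V(G)$ is admissible if it can be partitioned into three sets $X_1,X_2,X_3$ such that: (1) if $\{u,v\}\subseteq X_i$ for some $i$, then $v\notin N_G^1(u)\cup N_G^3(u)\cup N_G^5(u)$; (2) if $u\in X_i$ and $v\in X_j$ with $i\ne j$, then $v\notin N_G^1(u)\cup N_G^2(u)\cup N_G^4(u)$. -}

module Defs where

open import Data.Nat using (ℕ; zero; suc; _≤_; _+_)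
open import Data.Fin using (Fin; zero; suc; inject₁; fromℕ)
open import Data.Bool using (Bool; true; false)
open import Data.List using (List; length; filter)
open import Data.List using (allFin)
open import Data.Product using (Σ; ∃; _×_; _,_)
open import Relation.Binary.PropositionalEquality using (_≡_; _≢_)
open import Relation.Nullary using (¬_)
open import Function.Definitions using (Injective)
open import Data.Bool.Properties using (T?)
open import Data.Empty using (⊥)
open import Data.Unit using (⊤)

record SimpleGraph (n : ℕ) : Set where
  field
    Adj   : Fin n → Fin n → Bool
    sym   : ∀ u v → Adj u v ≡ Adj v u
    irrefl : ∀ v → Adj v v ≡ false
open SimpleGraph public

module _ {n : ℕ} (G : SimpleGraph n) where

  _~_ : Fin n → Fin n → Set
  u ~ v = Adj G u v ≡ true

  degree : Fin n → ℕ
  degree v = length (filter (λ w → T? (Adj G v w)) (allFin n))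

  MaxDegreeAtMost : ℕ → Set
  MaxDegreeAtMost d = ∀ v → degree v ≤ d

  TriangleFree : Set
  TriangleFree = ∀ u v w → u ~ v → v ~ w → w ~ u → ⊥

  PathIn : (Fin n → Set) → ℕ → Fin n → Fin n → Set
  PathIn P i u v =
    Σ (Fin (suc i) → Fin n) λ p →
      (p zero ≡ u) × (p (fromℕ i) ≡ v) × Injective _≡_ _≡_ p ×
      (∀ (j : Fin i) → p (inject₁ j) ~ p (suc j)) ×
      (∀ (j : Fin (suc i)) → P (p j))

  Path : ℕ → Fin n → Fin n → Set
  Path = PathIn (λ _ → ⊤)

  InN : ℕ → Fin n → Fin n → Set
  InN i u v = (v ≢ u) × Path i u v

  ConnectedOn : (Fin n → Set) → Set
  ConnectedOn P = ∀ u v → P u → P v → ∃ λ i → PathIn P i u v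

  Connected : Set
  Connected = ConnectedOn (λ _ → ⊤)

  TwoConnected : Set
  TwoConnected = (3 ≤ n) × Connected × (∀ x → ConnectedOn (λ w → w ≢ x))

  CycleOfLength3+ : ℕ → Set
  CycleOfLength3+ m = Σ (Fin (3 + m) → Fin n) λ c →
    Injective _≡_ _≡_ c ×
    (∀ (j : Fin (2 + m)) → c (inject₁ j) ~ c (suc j)) ×
    (c (fromℕ (2 + m)) ~ c zero)

  GirthAtMost : ℕ → Set
  GirthAtMost g = ∃ λ m → (3 + m ≤ g) × CycleOfLength3+ m

  -- X ⊆ V(G) is admissible (X given as a predicate); the partition
  -- X₁, X₂, X₃ is given by a labelling f into Fin 3
  Admissible : (Fin n → Set) → Set
  Admissible X = Σ (Fin n → Fin 3) λ f → ∀ u v → X u → X v →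
    ((f u ≡ f v) → ¬ InN 1 u v × ¬ InN 3 u v × ¬ InN 5 u v) ×
    ((f u ≢ f v) → ¬ InN 1 u v × ¬ InN 2 u v × ¬ InN 4 u v)

{-# OPTIONS --safe #-}

-- Pairs (part, label) are 126 colours, assigned greedily.  Count the colours
-- forbidden at v along the non-backtracking walks from v: an endpoint at length
-- 1 forbids 3 colours, at lengths 2 and 4 it forbids 2, at lengths 3 and 5 it
-- forbids 1, in total at most 3·3 + 2·6 + 12 + 2·24 + 48 = 129.  So it suffices
-- to save 4 at every vertex.  Colour the vertices of a short cycle last, and the
-- others towards the cycle.  A vertex off the cycle then has an uncoloured
-- neighbour w and a further uncoloured neighbour of w, which saves 3 + 2.
-- A vertex v on a cycle of length 4, 5 or 6 has two walks of length 4, one in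
-- each direction around the cycle, that end at distance at most 2 from v, where
-- the two colours are already forbidden (or at v itself); this saves 2 + 2.
module Submission where

open import Defs hiding (sym)
open import Data.Bool.Properties using (T?; T-≡)
open import Data.Fin using (Fin; zero; suc; inject₁; fromℕ; opposite; combine; remQuot; punchIn; punchOut)
open import Data.Fin.Properties using (_≟_; suc-injective; all?; ¬∀⟶∃¬; injective⇒≤; combine-remQuot; opposite-involutive; punchIn-punchOut)
open import Data.Fin.Relation.Unary.Top using (view; ‵fromℕ; ‵inject₁)
open import Data.List using (List; []; _∷_; _++_; length; map; filter; concatMap; allFin; tabulate; lookup)
open import Data.List.Membership.Propositional using (_∈_; _∉_)
open import Data.List.Membership.Propositional.Properties using (∈-++⁺ˡ; ∈-++⁺ʳ; ∈-++⁻; ∈-map⁺; ∈-filter⁺; ∈-filter⁻; ∈-concatMap⁺; ∈-tabulate⁺; ∈-tabulate⁻; ∈-allFin)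
open import Data.List.Properties using (length-++; length-map; filter-++; length-filter; filter-notAll)
open import Data.List.Relation.Unary.Any using (here; there; index)
open import Data.List.Relation.Unary.Any.Properties using (lookup-index)
import Data.List.Relation.Unary.Any as Any
open import Data.Nat using (ℕ; zero; suc; _+_; _*_; _^_; _≤_; _<_; z≤n; s≤s; s≤s⁻¹)
open import Data.Nat.GeneralisedArithmetic using (fold)
open import Data.Nat.Properties using (≤-refl; ≤-trans; ≤-reflexive; <⇒≱; +-mono-≤; *-monoˡ-≤; +-suc; m≤n+m; module ≤-Reasoning)
open import Data.Product using (Σ; ∃; _×_; _,_; proj₁; proj₂; uncurry)
open import Data.Sum using (inj₁; inj₂)
open import Function using (_∘_; Equivalence)
open import Relation.Binary.PropositionalEquality using (_≡_; _≢_; refl; sym; trans; cong; subst)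
open import Relation.Nullary using (¬_; yes; no; ¬?; contradiction; from-yes)
open import Relation.Unary using (Decidable)

-- Counting in concatenated lists

module _ {A B : Set} (f : A → List B) (M : ℕ) where

  length-concatMap-≤ : ∀ xs → (∀ x → x ∈ xs → length (f x) ≤ M) →
    length (concatMap f xs) ≤ length xs * M
  length-concatMap-≤ [] _ = z≤n
  length-concatMap-≤ (x ∷ xs) b = begin
    length (f x ++ concatMap f xs)           ≡⟨ length-++ (f x) ⟩
    length (f x) + length (concatMap f xs)   ≤⟨ +-mono-≤ (b x (here refl)) (length-concatMap-≤ xs (λ y → b y ∘ there)) ⟩
    M + length xs * M                        ∎
    where open ≤-Reasoning

  length-concatMap-< : ∀ xs → (∀ x → x ∈ xs → length (f x) ≤ M) →
    ∀ {a} → a ∈ xs → length (f a) < M → length (concatMap f xs) < length xs * M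
  length-concatMap-< (x ∷ xs) b (here refl) s = begin
    suc (length (f x ++ concatMap f xs))         ≡⟨ cong suc (length-++ (f x)) ⟩
    suc (length (f x)) + length (concatMap f xs) ≤⟨ +-mono-≤ s (length-concatMap-≤ xs (λ y → b y ∘ there)) ⟩
    M + length xs * M                            ∎
    where open ≤-Reasoning
  length-concatMap-< (x ∷ xs) b (there p) s = begin
    suc (length (f x ++ concatMap f xs))         ≡⟨ cong suc (length-++ (f x)) ⟩
    suc (length (f x) + length (concatMap f xs)) ≡⟨ +-suc (length (f x)) _ ⟨
    length (f x) + suc (length (concatMap f xs)) ≤⟨ +-mono-≤ (b x (here refl)) (length-concatMap-< xs (λ y → b y ∘ there) p s) ⟩
    M + length xs * M                            ∎
    where open ≤-Reasoning

  -- Distinct entries sit at distinct positions, so the two savings fall on different summands and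
  -- add up.
  length-concatMap-<₂ : ∀ xs → (∀ x → x ∈ xs → length (f x) ≤ M) →
    ∀ {a a′} → a ≢ a′ → a ∈ xs → length (f a) < M → a′ ∈ xs → length (f a′) < M →
    2 + length (concatMap f xs) ≤ length xs * M
  length-concatMap-<₂ (x ∷ xs) b a≢a′ (here refl) _ (here refl) _ = contradiction refl a≢a′
  length-concatMap-<₂ (x ∷ xs) b a≢a′ (here refl) s (there p) s′ = begin
    2 + length (f x ++ concatMap f xs)                 ≡⟨ cong (2 +_) (length-++ (f x)) ⟩
    2 + (length (f x) + length (concatMap f xs))       ≡⟨ cong suc (+-suc (length (f x)) _) ⟨
    suc (length (f x)) + suc (length (concatMap f xs)) ≤⟨ +-mono-≤ s (length-concatMap-< xs (λ y → b y ∘ there) p s′) ⟩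
    M + length xs * M                                  ∎
    where open ≤-Reasoning
  -- By symmetry the entry at the head may be taken as `a`.
  length-concatMap-<₂ (x ∷ xs) b a≢a′ (there p) s (here refl) s′ =
    length-concatMap-<₂ (x ∷ xs) b (a≢a′ ∘ sym) (here refl) s′ (there p) s
  length-concatMap-<₂ (x ∷ xs) b a≢a′ (there p) s (there p′) s′ = begin
    2 + length (f x ++ concatMap f xs)           ≡⟨ cong (2 +_) (length-++ (f x)) ⟩
    2 + (length (f x) + length (concatMap f xs)) ≡⟨ cong suc (+-suc (length (f x)) _) ⟨
    suc (length (f x) + suc (length (concatMap f xs))) ≡⟨ +-suc (length (f x)) _ ⟨
    length (f x) + (2 + length (concatMap f xs)) ≤⟨ +-mono-≤ (b x (here refl)) (length-concatMap-<₂ xs (λ y → b y ∘ there) a≢a′ p s p′ s′) ⟩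
    M + length xs * M                            ∎
    where open ≤-Reasoning

filter-concatMap : {A B : Set} {P : B → Set} (P? : Decidable P) (f : A → List B) → ∀ xs →
  filter P? (concatMap f xs) ≡ concatMap (filter P? ∘ f) xs
filter-concatMap P? f [] = refl
filter-concatMap P? f (x ∷ xs) =
  trans (filter-++ P? (f x) (concatMap f xs)) (cong (filter P? (f x) ++_) (filter-concatMap P? f xs))

filter-∌-< : {A : Set} {P : A → Set} (P? : Decidable P) {xs : List A} {x : A} →
  x ∈ xs → ¬ P x → length (filter P? xs) < length xs
filter-∌-< P? {xs} x∈ ¬px = filter-notAll P? xs (Any.map (λ { refl → ¬px }) x∈)

module _ {m : ℕ} where
  open import Data.List.Membership.DecPropositional (_≟_ {m}) using (_∈?_)

  -- Pigeonhole: if every element occurred in `L`, its position would determine it, which injects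
  -- `Fin m` into `Fin (length L)`.
  ∃-∉-Fin : (L : List (Fin m)) → length L < m → ∃ (_∉ L)
  ∃-∉-Fin L L<m = ¬∀⟶∃¬ m (_∈ L) (_∈? L) λ all∈ →
    <⇒≱ L<m (injective⇒≤ {f = index ∘ all∈} λ {c} {d} eq →
      trans (lookup-index (all∈ c)) (trans (cong (lookup L) eq) (sym (lookup-index (all∈ d)))))

∃-∉-× : ∀ {k l} (L : List (Fin k × Fin l)) → length L < k * l → ∃ (_∉ L)
∃-∉-× {k} {l} L L< with ∃-∉-Fin (map (uncurry combine) L) (subst (_< k * l) (sym (length-map _ L)) L<)
... | c , c∉ = remQuot {k} l c ,
  λ c∈ → c∉ (subst (_∈ _) (combine-remQuot {k} l c) (∈-map⁺ (uncurry combine) c∈))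

-- Indices around a cycle

next : ∀ {n} → Fin (suc n) → Fin (suc n)
next j with view j
... | ‵fromℕ     = zero
... | ‵inject₁ i = suc i

-- Only the cycle lengths 4, 5 and 6 arise, so each case is decided by evaluation.
fold-next : ∀ r → r ≤ 2 → (j : Fin (4 + r)) → fold j next (4 + r) ≡ j
fold-next 0 _ = from-yes (all? (λ (j : Fin 4) → fold j next 4 ≟ j))
fold-next 1 _ = from-yes (all? (λ (j : Fin 5) → fold j next 5 ≟ j))
fold-next 2 _ = from-yes (all? (λ (j : Fin 6) → fold j next 6 ≟ j))
fold-next (suc (suc (suc _))) (s≤s (s≤s ()))

next²-≢ : ∀ r → r ≤ 2 → (j : Fin (4 + r)) → j ≢ next (next j)
next²-≢ 0 _ = from-yes (all? (λ (j : Fin 4) → ¬? (j ≟ next (next j))))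
next²-≢ 1 _ = from-yes (all? (λ (j : Fin 5) → ¬? (j ≟ next (next j))))
next²-≢ 2 _ = from-yes (all? (λ (j : Fin 6) → ¬? (j ≟ next (next j))))
next²-≢ (suc (suc (suc _))) (s≤s (s≤s ()))

opposite-inject₁ : ∀ {n} (j : Fin n) → opposite (inject₁ j) ≡ suc (opposite j)
opposite-inject₁ zero    = refl
opposite-inject₁ (suc j) = cong inject₁ (opposite-inject₁ j)

opposite-fromℕ : ∀ n → opposite (fromℕ n) ≡ zero
opposite-fromℕ zero    = refl
opposite-fromℕ (suc n) = cong inject₁ (opposite-fromℕ n)

-- Colours and lists of forbidden colours

Colour : Set
Colour = Fin 42 × Fin 3

allLabels : Colour → List Colour
allLabels (a , _) = tabulate (a ,_)

-- `punchIn j` runs through the two labels other than `j`, so the list has length 2 by computation.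
otherLabels : Colour → List Colour
otherLabels (a , j) = tabulate (λ k → a , punchIn j k)

∈-allLabels : ∀ ((a , j) : Colour) i → (a , i) ∈ allLabels (a , j)
∈-allLabels (a , _) = ∈-tabulate⁺ {f = a ,_}

∈-otherLabels : ∀ ((a , j) : Colour) {i} → i ≢ j → (a , i) ∈ otherLabels (a , j)
∈-otherLabels (a , j) i≢j =
  subst (λ k → (a , k) ∈ otherLabels (a , j)) (punchIn-punchOut (i≢j ∘ sym))
    (∈-tabulate⁺ {f = λ k → a , punchIn j k} (punchOut (i≢j ∘ sym)))

-- Abstract, since unfolding the search through 126 colours stalls the type checker.
abstract
  ∃-∉-Colour : (L : List Colour) → length L ≤ 125 → ∃ (_∉ L)
  ∃-∉-Colour L L≤ = ∃-∉-× L (s≤s L≤)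

-- Paths and non-backtracking walks

module _ {n : ℕ} (G : SimpleGraph n) where
  open import Data.List.Membership.DecPropositional (_≟_ {n}) using (_∈?_)

  private
    V : Set
    V = Fin n

    infix 4 _∼_
    _∼_ : V → V → Set
    _∼_ = _~_ G

  ∼-sym : ∀ {u v} → u ∼ v → v ∼ u
  ∼-sym {u} {v} e = trans (SimpleGraph.sym G v u) e

  InN-sym : ∀ {i u v} → InN G i u v → InN G i v u
  InN-sym {i} (v≢u , p , p₀ , pᵢ , inj , adj , _) =
    v≢u ∘ sym , p ∘ opposite , pᵢ , trans (cong p (opposite-fromℕ i)) p₀ ,
    (λ {j} {k} eq → trans (sym (opposite-involutive j)) (trans (cong opposite (inj eq)) (opposite-involutive k))) ,
    (λ j → subst (λ k → p k ∼ p (inject₁ (opposite j))) (sym (opposite-inject₁ j)) (∼-sym (adj (opposite j)))) ,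
    _

  nbrs : V → List V
  nbrs v = filter (λ w → T? (Adj G v w)) (allFin n)

  ∈-nbrs⁺ : ∀ {v w} → v ∼ w → w ∈ nbrs v
  ∈-nbrs⁺ {v} {w} e = ∈-filter⁺ (λ w → T? (Adj G v w)) (∈-allFin w) (Equivalence.from T-≡ e)

  ∈-nbrs⁻ : ∀ {v w} → w ∈ nbrs v → v ∼ w
  ∈-nbrs⁻ {v} w∈ = Equivalence.to T-≡ (proj₂ (∈-filter⁻ (λ w → T? (Adj G v w)) {xs = allFin n} w∈))

  nbrsExcept : V → V → List V
  nbrsExcept u w = filter (λ x → ¬? (x ≟ u)) (nbrs w)

  -- Endpoints, with multiplicity, of the non-backtracking walks of length k + 1
  -- that start with the step u, w.
  walksVia : ℕ → V → V → List V
  walksVia zero    u w = w ∷ []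
  walksVia (suc k) u w = concatMap (walksVia k w) (nbrsExcept u w)

  walks : ℕ → V → List V
  walks zero    v = v ∷ []
  walks (suc k) v = concatMap (walksVia k v) (nbrs v)

  walksVia-step : ∀ {k u w x y} → w ∼ x → x ≢ u → y ∈ walksVia k w x → y ∈ walksVia (suc k) u w
  walksVia-step {k} {u} {w} {x} e x≢u y∈ = ∈-concatMap⁺ (walksVia k w)
    (Any.map (λ { refl → y∈ }) (∈-filter⁺ (λ x → ¬? (x ≟ u)) (∈-nbrs⁺ e) x≢u))

  walks-step : ∀ {k v w y} → v ∼ w → y ∈ walksVia k v w → y ∈ walks (suc k) v
  walks-step {k} {v} e y∈ = ∈-concatMap⁺ (walksVia k v) (Any.map (λ { refl → y∈ }) (∈-nbrs⁺ e))

  nbr∈walks : ∀ {v w} → v ∼ w → w ∈ walks 1 v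
  nbr∈walks e = walks-step {0} e (here refl)

  nbr²∈walks : ∀ {v w x} → v ∼ w → w ∼ x → x ≢ v → x ∈ walks 2 v
  nbr²∈walks e e′ x≢v = walks-step {1} e (walksVia-step {0} e′ x≢v (here refl))

  -- Injectivity separates vertices two steps apart, so a path never backtracks.
  path∈walksVia : ∀ k (p : Fin (2 + k) → V) → (∀ {i j} → p i ≡ p j → i ≡ j) →
    (∀ j → p (inject₁ j) ∼ p (suc j)) → p (fromℕ (suc k)) ∈ walksVia k (p zero) (p (suc zero))
  path∈walksVia zero    p inj adj = here refl
  path∈walksVia (suc k) p inj adj = walksVia-step {k} (adj (suc zero)) (λ eq → contradiction (inj eq) (λ ()))
    (path∈walksVia k (p ∘ suc) (λ eq → suc-injective (inj eq)) (adj ∘ suc))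

  InN⇒∈walks : ∀ {k u v} → InN G (suc k) u v → v ∈ walks (suc k) u
  InN⇒∈walks {k} (_ , p , refl , refl , inj , adj , _) =
    walks-step {k} (adj zero) (path∈walksVia k p inj adj)

  -- Ending here, a walk of length 4 forbids nothing new: `v` has no constraint with itself, and a
  -- coloured vertex reached by a walk of length 1 or 2 already forbids the labels in question.
  near : V → List V
  near v = walks 0 v ++ walks 1 v ++ walks 2 v

  self∈near : ∀ {v} → v ∈ near v
  self∈near = here refl

  nbr∈near : ∀ {v w} → v ∼ w → w ∈ near v
  nbr∈near {v} e = ∈-++⁺ʳ (walks 0 v) (∈-++⁺ˡ (nbr∈walks e))

  nbr²∈near : ∀ {v w x} → v ∼ w → w ∼ x → x ≢ v → x ∈ near v
  nbr²∈near {v} e e′ x≢v = ∈-++⁺ʳ (walks 0 v) (∈-++⁺ʳ (walks 1 v) (nbr²∈walks e e′ x≢v))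

  far? : ∀ v → Decidable (_∉ near v)
  far? v u = ¬? (u ∈? near v)

  farWalks₄ : V → List V
  farWalks₄ v = filter (far? v) (walks 4 v)

  -- Partial colourings

  Compatible : Colour → Colour → V → V → Set
  Compatible (a , i) (b , j) u v = a ≡ b →
    ((i ≡ j) → ¬ InN G 1 u v × ¬ InN G 3 u v × ¬ InN G 5 u v) ×
    ((i ≢ j) → ¬ InN G 1 u v × ¬ InN G 2 u v × ¬ InN G 4 u v)

  Compatible-sym : ∀ {c d u v} → Compatible c d u v → Compatible d c v u
  Compatible-sym h a≡b with h (sym a≡b)
  ... | same , diff =
    (λ eq → let (p , q , r) = same (sym eq) in p ∘ InN-sym , q ∘ InN-sym , r ∘ InN-sym) ,
    (λ ne → let (p , q , r) = diff (ne ∘ sym) in p ∘ InN-sym , q ∘ InN-sym , r ∘ InN-sym)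

  Compatible-self : ∀ {c d v} → Compatible c d v v
  Compatible-self {v = v} _ = (λ _ → irr , irr , irr) , (λ _ → irr , irr , irr)
    where
    irr : ∀ {i} → ¬ InN G i v v
    irr (v≢v , _) = v≢v refl

  -- A partial colouring is encoded as a total one whose values on the uncoloured vertices `xs` are
  -- ignored.
  ValidOutside : List V → (V → Colour) → Set
  ValidOutside xs col = ∀ u v → u ∉ xs → v ∉ xs → Compatible (col u) (col v) u v

  Extendable : List V → Set
  Extendable xs = ∀ col → ValidOutside xs col → ∃ (ValidOutside [])

  outside : List V → List V → List V
  outside xs = filter (λ u → ¬? (u ∈? xs))

  -- Colours forbidden at a vertex

  module _ (xs : List V) (v : V) (col : V → Colour) where

    -- Uncoloured endpoints are discarded only at lengths 1 and 2, where their savings are counted;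
    -- elsewhere their arbitrary colours merely lengthen the list.
    forbidden₁ forbidden₂ forbidden₃ forbidden₄ forbidden₅ forbidden : List Colour
    forbidden₁ = concatMap (allLabels ∘ col) (outside xs (walks 1 v))
    forbidden₂ = concatMap (otherLabels ∘ col) (outside xs (walks 2 v))
    forbidden₃ = map col (walks 3 v)
    forbidden₄ = concatMap (otherLabels ∘ col) (farWalks₄ v)
    forbidden₅ = map col (walks 5 v)
    forbidden  = forbidden₁ ++ forbidden₂ ++ forbidden₃ ++ forbidden₄ ++ forbidden₅

    private
      ⊆₁ : ∀ {c} → c ∈ forbidden₁ → c ∈ forbidden
      ⊆₁ = ∈-++⁺ˡ
      ⊆₂ : ∀ {c} → c ∈ forbidden₂ → c ∈ forbidden
      ⊆₂ = ∈-++⁺ʳ forbidden₁ ∘ ∈-++⁺ˡ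
      ⊆₃ : ∀ {c} → c ∈ forbidden₃ → c ∈ forbidden
      ⊆₃ = ∈-++⁺ʳ forbidden₁ ∘ ∈-++⁺ʳ forbidden₂ ∘ ∈-++⁺ˡ
      ⊆₄ : ∀ {c} → c ∈ forbidden₄ → c ∈ forbidden
      ⊆₄ = ∈-++⁺ʳ forbidden₁ ∘ ∈-++⁺ʳ forbidden₂ ∘ ∈-++⁺ʳ forbidden₃ ∘ ∈-++⁺ˡ
      ⊆₅ : ∀ {c} → c ∈ forbidden₅ → c ∈ forbidden
      ⊆₅ = ∈-++⁺ʳ forbidden₁ ∘ ∈-++⁺ʳ forbidden₂ ∘ ∈-++⁺ʳ forbidden₃ ∘ ∈-++⁺ʳ forbidden₄

    allowed⇒Compatible : ∀ {c u} → c ∉ forbidden → u ∉ xs → Compatible c (col u) v u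
    allowed⇒Compatible {a , i} {u} c∉ u∉ refl =
      (λ { refl → adjacent
                , (λ h → c∉ (⊆₃ (∈-map⁺ col (InN⇒∈walks {2} h))))
                , (λ h → c∉ (⊆₅ (∈-map⁺ col (InN⇒∈walks {4} h)))) }) ,
      λ i≢j → adjacent , (λ h → dist₂ i≢j (InN⇒∈walks {1} h)) , dist₄ i≢j
      where
      coloured : ∀ {ys} → u ∈ ys → u ∈ outside xs ys
      coloured u∈ = ∈-filter⁺ (λ u → ¬? (u ∈? xs)) u∈ u∉
      emit : ∀ {c} {f : Colour → List Colour} {ys} → u ∈ ys → c ∈ f (col u) → c ∈ concatMap (f ∘ col) ys
      emit u∈ c∈ = ∈-concatMap⁺ _ (Any.map (λ { refl → c∈ }) u∈)
      dist₁ : u ∉ walks 1 v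
      dist₁ u∈ = c∉ (⊆₁ (emit {f = allLabels} (coloured u∈) (∈-allLabels (col u) i)))
      adjacent : ¬ InN G 1 v u
      adjacent h = dist₁ (InN⇒∈walks {0} h)
      dist₂ : i ≢ proj₂ (col u) → u ∉ walks 2 v
      dist₂ i≢j u∈ = c∉ (⊆₂ (emit {f = otherLabels} (coloured u∈) (∈-otherLabels (col u) i≢j)))
      dist₄ : i ≢ proj₂ (col u) → ¬ InN G 4 v u
      dist₄ i≢j h@(u≢v , _) = c∉ (⊆₄ (emit {f = otherLabels} (∈-filter⁺ (far? v) (InN⇒∈walks {3} h) notNear) (∈-otherLabels (col u) i≢j)))
        where
        -- `u` differs from `v`, and at length 1 or 2 the colour `c` would already be forbidden.
        notNear : u ∉ near v
        notNear (here u≡v) = u≢v u≡v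
        notNear (there u∈) with ∈-++⁻ (walks 1 v) u∈
        ... | inj₁ u∈₁ = dist₁ u∈₁
        ... | inj₂ u∈₂ = dist₂ i≢j u∈₂

    length-forbidden : ∀ {b₁ b₂ b₃ b₄ b₅} →
      length (outside xs (walks 1 v)) ≤ b₁ → length (outside xs (walks 2 v)) ≤ b₂ →
      length (walks 3 v) ≤ b₃ → length (farWalks₄ v) ≤ b₄ → length (walks 5 v) ≤ b₅ →
      length forbidden ≤ b₁ * 3 + (b₂ * 2 + (b₃ + (b₄ * 2 + b₅)))
    length-forbidden h₁ h₂ h₃ h₄ h₅ =
      append {forbidden₁} (emits (outside xs (walks 1 v)) allLabels (λ _ → ≤-refl) h₁)
      (append {forbidden₂} (emits (outside xs (walks 2 v)) otherLabels (λ _ → ≤-refl) h₂)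
      (append {forbidden₃} (≤-trans (≤-reflexive (length-map col (walks 3 v))) h₃)
      (append {forbidden₄} (emits (farWalks₄ v) otherLabels (λ _ → ≤-refl) h₄)
      (≤-trans (≤-reflexive (length-map col (walks 5 v))) h₅))))
      where
      append : ∀ {xs ys : List Colour} {k l} → length xs ≤ k → length ys ≤ l → length (xs ++ ys) ≤ k + l
      append {xs} p q = ≤-trans (≤-reflexive (length-++ xs)) (+-mono-≤ p q)
      emits : ∀ {k b} ys (f : Colour → List Colour) → (∀ c → length (f c) ≤ k) → length ys ≤ b →
        length (concatMap (f ∘ col) ys) ≤ b * k
      emits {k} {b} ys f f≤ ys≤ =
        ≤-trans (length-concatMap-≤ (f ∘ col) k ys (λ x _ → f≤ (col x))) (*-monoˡ-≤ k ys≤)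

  -- Greedy extension by one vertex

  recolour : (V → Colour) → V → Colour → V → Colour
  recolour col v c w with w ≟ v
  ... | yes _ = c
  ... | no  _ = col w

  Choosable : List V → V → Set
  Choosable xs v = ∀ (col : V → Colour) → ∃ λ c → ∀ {u} → u ∉ xs → Compatible c (col u) v u

  few-forbidden⇒Choosable : ∀ xs v → (∀ col → length (forbidden xs v col) ≤ 125) → Choosable xs v
  few-forbidden⇒Choosable xs v bound col =
    let (c , c∉) = ∃-∉-Colour (forbidden xs v col) (bound col)
    in c , allowed⇒Compatible xs v col c∉

  -- Only pairs containing `v` are new. The choice of `c` settles them with `v` first, and symmetry
  -- gives the other order.
  extend : ∀ {xs v} → Choosable (v ∷ xs) v → Extendable xs → Extendable (v ∷ xs)
  extend {xs} {v} choose ext col valid with choose col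
  ... | c , c-ok = ext (recolour col v c) valid′
    where
    outside∷ : ∀ {u} → u ≢ v → u ∉ xs → u ∉ v ∷ xs
    outside∷ u≢v u∉ (here u≡v) = u≢v u≡v
    outside∷ u≢v u∉ (there u∈) = u∉ u∈
    valid′ : ValidOutside xs (recolour col v c)
    valid′ u w u∉ w∉ with u ≟ v | w ≟ v
    ... | yes refl | yes refl = Compatible-self {c}
    ... | yes refl | no w≢v   = c-ok (outside∷ w≢v w∉)
    ... | no u≢v   | yes refl = Compatible-sym {c} {col u}
                                  (c-ok (outside∷ u≢v u∉))
    ... | no u≢v   | no w≢v   = valid u w (outside∷ u≢v u∉) (outside∷ w≢v w∉)

  -- Counting walks under the degree bound

  module _ (deg≤3 : MaxDegreeAtMost G 3) where

    -- `u` is one of the at most three neighbours of `w`, and it is filtered out.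
    length-nbrsExcept : ∀ {u w} → u ∼ w → length (nbrsExcept u w) ≤ 2
    length-nbrsExcept {u} {w} e = s≤s⁻¹ (≤-trans
      (filter-∌-< (λ x → ¬? (x ≟ u)) (∈-nbrs⁺ (∼-sym e)) (λ u≢u → u≢u refl)) (deg≤3 w))

    length-walksVia : ∀ k {u w} → u ∼ w → length (walksVia k u w) ≤ 2 ^ k
    length-walksVia zero    e = ≤-refl
    length-walksVia (suc k) {u} {w} e = ≤-trans
      (length-concatMap-≤ (walksVia k w) (2 ^ k) (nbrsExcept u w)
        (λ x x∈ → length-walksVia k (∈-nbrs⁻ (proj₁ (∈-filter⁻ (λ x → ¬? (x ≟ u)) {xs = nbrs w} x∈)))))
      (*-monoˡ-≤ (2 ^ k) (length-nbrsExcept e))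

    length-walks : ∀ k v → length (walks (suc k) v) ≤ 3 * 2 ^ k
    length-walks k v = ≤-trans
      (length-concatMap-≤ (walksVia k v) (2 ^ k) (nbrs v) (λ x x∈ → length-walksVia k (∈-nbrs⁻ x∈)))
      (*-monoˡ-≤ (2 ^ k) (deg≤3 v))

    -- Two fewer than the general bound of 24 walks of length 4.
    FewFarWalks : V → Set
    FewFarWalks v = length (farWalks₄ v) ≤ 22

    -- Different first steps put the two walks into different blocks of the concatenation. Each
    -- block has at most 8 walks, and each of these two loses one.
    two-near-walks : ∀ {v w w′ y y′} → w ≢ w′ →
      v ∼ w  → y  ∈ walksVia 3 v w  → y  ∈ near v →
      v ∼ w′ → y′ ∈ walksVia 3 v w′ → y′ ∈ near v → FewFarWalks v
    two-near-walks {v} w≢w′ e y∈ yn e′ y′∈ yn′ = s≤s⁻¹ (s≤s⁻¹ (≤-trans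
      (≤-reflexive (cong (λ ys → 2 + length ys) (filter-concatMap (far? v) (walksVia 3 v) (nbrs v))))
      (≤-trans
        (length-concatMap-<₂ (filter (far? v) ∘ walksVia 3 v) 8 (nbrs v)
          (λ x x∈ → ≤-trans (length-filter (far? v) (walksVia 3 v x)) (length-walksVia 3 (∈-nbrs⁻ x∈)))
          w≢w′ (∈-nbrs⁺ e) (fewer e y∈ yn) (∈-nbrs⁺ e′) (fewer e′ y′∈ yn′))
        (*-monoˡ-≤ 8 (deg≤3 v)))))
      where
      fewer : ∀ {w y} → v ∼ w → y ∈ walksVia 3 v w → y ∈ near v →
        length (filter (far? v) (walksVia 3 v w)) < 8
      fewer e y∈ yn = ≤-trans (filter-∌-< (far? v) y∈ (λ y∉ → y∉ yn)) (length-walksVia 3 e)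

    module _ (s : ℕ → V) (adj : ∀ k → s k ∼ s (suc k)) (nonback : ∀ k → s k ≢ s (2 + k)) where

      -- The sequence `s` unrolls a cycle of length `4 + r`. Going forward, `s 4` is `r` steps short
      -- of the return to `s 0`; going backward from `s (4 + r)`, four steps end at `s r`. As `r` is
      -- at most 2, both ends lie in `near (s 0)`.
      closedWalk⇒FewFarWalks : ∀ r → r ≤ 2 → s (4 + r) ≡ s 0 → s (5 + r) ≡ s 1 → FewFarWalks (s 0)
      closedWalk⇒FewFarWalks r r≤2 eq₀ eq₁ = two-near-walks
        -- The first steps differ: `s 1` equals `s (5 + r)`, two places after `s (3 + r)`.
        (λ eq → nonback (3 + r) (trans (sym eq) (sym eq₁)))
        (adj 0)
        (walksVia-step {2} (adj 1) (nonback 0 ∘ sym) (walksVia-step {1} (adj 2) (nonback 1 ∘ sym)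
          (walksVia-step {0} (adj 3) (nonback 2 ∘ sym) (here refl))))
        (ahead r r≤2 eq₀)
        (subst (_∼ s (3 + r)) eq₀ (∼-sym (adj (3 + r))))
        (subst (λ x → s r ∈ walksVia 3 x (s (3 + r))) eq₀
          (walksVia-step {2} (∼-sym (adj (2 + r))) (nonback (2 + r))
            (walksVia-step {1} (∼-sym (adj (1 + r))) (nonback (1 + r))
              (walksVia-step {0} (∼-sym (adj r)) (nonback r) (here refl)))))
        (behind r r≤2)
        where
        ahead : ∀ r → r ≤ 2 → s (4 + r) ≡ s 0 → s 4 ∈ near (s 0)
        ahead 0 _ eq = subst (λ x → s 4 ∈ near x) eq self∈near
        ahead 1 _ eq = subst (λ x → s 4 ∈ near x) eq (nbr∈near (∼-sym (adj 4)))
        ahead 2 _ eq = subst (λ x → s 4 ∈ near x) eq (nbr²∈near (∼-sym (adj 5)) (∼-sym (adj 4)) (nonback 4))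
        ahead (suc (suc (suc _))) (s≤s (s≤s ()))
        behind : ∀ r → r ≤ 2 → s r ∈ near (s 0)
        behind 0 _ = self∈near
        behind 1 _ = nbr∈near (adj 0)
        behind 2 _ = nbr²∈near (adj 0) (adj 1) (nonback 0 ∘ sym)
        behind (suc (suc (suc _))) (s≤s (s≤s ()))

    -- The count is 3·3 + 6·2 + 12 + 22·2 + 48 = 125, whichever other vertices are coloured.
    extend-FewFarWalks : ∀ {xs v} → FewFarWalks v → Extendable xs → Extendable (v ∷ xs)
    extend-FewFarWalks {xs} {v} few = extend (few-forbidden⇒Choosable (v ∷ xs) v λ col → length-forbidden (v ∷ xs) v col
      (≤-trans (length-filter _ (walks 1 v)) (length-walks 0 v))
      (≤-trans (length-filter _ (walks 2 v)) (length-walks 1 v))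
      (length-walks 2 v) few (length-walks 4 v))

    -- The uncoloured `w` saves an endpoint at length 1 and `x` one at length 2: 2·3 + 5·2 + 12 +
    -- 24·2 + 48 = 124.
    extend-linked : ∀ {xs v w x} → v ∼ w → w ∼ x → w ∈ xs → x ∈ xs → v ∉ xs →
      Extendable xs → Extendable (v ∷ xs)
    extend-linked {xs} {v} {w} {x} e e′ w∈ x∈ v∉ = extend (few-forbidden⇒Choosable (v ∷ xs) v λ col → ≤-trans
      (length-forbidden (v ∷ xs) v col {b₁ = 2} {b₂ = 5}
        (fewer (nbr∈walks e) w∈ (length-walks 0 v))
        -- The walk through `w` to `x` does not backtrack, since `x` is in `xs` and `v` is not.
        (fewer (nbr²∈walks e e′ (λ { refl → v∉ x∈ })) x∈ (length-walks 1 v))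
        (length-walks 2 v)
        (≤-trans (length-filter (far? v) (walks 4 v)) (length-walks 3 v)) (length-walks 4 v))
      (m≤n+m 124 1))
      where
      fewer : ∀ {y ys b} → y ∈ ys → y ∈ xs → length ys ≤ suc b → length (outside (v ∷ xs) ys) ≤ b
      fewer y∈ys y∈xs ys≤ = s≤s⁻¹ (≤-trans (filter-∌-< _ y∈ys (λ y∉ → y∉ (there y∈xs))) ys≤)

    -- Growing the set of uncoloured vertices

    Linked : List V → Set
    Linked xs = ∀ {w} → w ∈ xs → ∃ λ x → w ∼ x × x ∈ xs

    -- Vertices outside xs are coloured before those in xs, so adding v to xs colours v first.
    Region : List V → Set
    Region xs = Linked xs × Extendable xs

    -- Linkedness of `w` supplies the second uncoloured vertex that `extend-linked` asks for. A new
    -- `v` is linked through `w`, so the invariant persists.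
    grow : ∀ {xs v w} → w ∈ xs → w ∼ v → Region xs → ∃ λ ys → Region ys × (∀ {x} → x ∈ v ∷ xs → x ∈ ys)
    grow {xs} {v} {w} w∈ e reg@(linked , ext) with v ∈? xs
    ... | yes v∈ = xs , reg , λ { (here refl) → v∈ ; (there x∈) → x∈ }
    ... | no v∉ with linked w∈
    ...   | x , e′ , x∈ = v ∷ xs , (linked′ , extend-linked (∼-sym e) e′ w∈ x∈ v∉ ext) , λ x∈ → x∈
      where
      linked′ : Linked (v ∷ xs)
      linked′ (here refl) = w , ∼-sym e , there w∈
      linked′ (there y∈) with linked y∈
      ... | z , e″ , z∈ = z , e″ , there z∈

    grow-path : ∀ k (p : Fin (suc k) → V) → (∀ j → p (inject₁ j) ∼ p (suc j)) →
      ∀ {xs} → p zero ∈ xs → Region xs → ∃ λ ys → Region ys × p (fromℕ k) ∈ ys × (∀ {x} → x ∈ xs → x ∈ ys)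
    grow-path zero    p adj {xs} p₀∈ reg = xs , reg , p₀∈ , λ x∈ → x∈
    grow-path (suc k) p adj p₀∈ reg with grow p₀∈ (adj zero) reg
    ... | ys , reg′ , ⊆ys with grow-path k (p ∘ suc) (adj ∘ suc) (⊆ys (here refl)) reg′
    ...   | zs , reg″ , p∈ , ⊆zs = zs , reg″ , p∈ , ⊆zs ∘ ⊆ys ∘ there

    module _ (connected : Connected G) where

      -- A path from `r` starts inside the region, so growing along it absorbs its other end.
      grow-to : ∀ vs {xs r} → r ∈ xs → Region xs →
        ∃ λ ys → Region ys × (∀ {v} → v ∈ vs → v ∈ ys) × (∀ {x} → x ∈ xs → x ∈ ys)
      grow-to [] {xs} r∈ reg = xs , reg , (λ ()) , λ x∈ → x∈
      grow-to (v ∷ vs) {xs} {r} r∈ reg with connected r v _ _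
      ... | k , p , refl , refl , _ , adj , _ with grow-path k p adj r∈ reg
      ...   | ys , reg′ , v∈ , ⊆ys with grow-to vs (⊆ys r∈) reg′
      ...     | zs , reg″ , vs⊆ , ⊆zs =
        zs , reg″ , (λ { (here refl) → ⊆zs v∈ ; (there w∈) → vs⊆ w∈ }) , ⊆zs ∘ ⊆ys

      Region⇒valid : ∀ {xs r} → r ∈ xs → Region xs → ∃ (ValidOutside [])
      Region⇒valid r∈ reg with grow-to (allFin n) r∈ reg
      ... | ys , (_ , ext) , all∈ , _ =
        -- The region now contains every vertex, so any starting colouring is vacuously valid
        -- outside it.
        ext (λ _ → zero , zero) (λ u v u∉ → contradiction (all∈ (∈-allFin u)) u∉)

    -- The short cycle as the initial region

    Extendable-FewFarWalks : ∀ xs → (∀ {v} → v ∈ xs → FewFarWalks v) → Extendable xs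
    Extendable-FewFarWalks []       _   col valid = col , valid
    Extendable-FewFarWalks (x ∷ xs) few =
      extend-FewFarWalks (few (here refl)) (Extendable-FewFarWalks xs (few ∘ there))

    cycle-next : ∀ {m} ((c , _) : CycleOfLength3+ G m) → ∀ j → c j ∼ c (next j)
    cycle-next (c , _ , adj , close) j with view j
    ... | ‵fromℕ     = close
    ... | ‵inject₁ i = adj i

    cycle⇒Region : ∀ r → r ≤ 2 → ((c , _) : CycleOfLength3+ G (suc r)) → Region (tabulate c)
    cycle⇒Region r r≤2 C@(c , inj , _) =
      (λ w∈ → let (j , eq) = ∈-tabulate⁻ {f = c} w∈ in
        c (next j) , subst (_∼ c (next j)) (sym eq) (cycle-next C j) , ∈-tabulate⁺ {f = c} (next j)) ,
      Extendable-FewFarWalks (tabulate c) λ v∈ → let (j , eq) = ∈-tabulate⁻ {f = c} v∈ in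
        subst FewFarWalks (sym eq) (few j)
      where
      few : ∀ j → FewFarWalks (c j)
      -- Iterating `next` from `j` unrolls the cycle, making each of its vertices the start of a
      -- closed walk.
      few j = closedWalk⇒FewFarWalks (λ k → c (fold j next k))
        (λ k → cycle-next C (fold j next k))
        (λ k eq → next²-≢ r r≤2 (fold j next k) (inj eq))
        r r≤2 (cong c (fold-next r r≤2 j)) (cong (c ∘ next) (fold-next r r≤2 j))

-- From a colouring to the partition

valid⇒partition : ∀ {n} (G : SimpleGraph n) → ∃ (ValidOutside G []) →
  Σ (Fin n → Fin 42) λ part → ∀ a → Admissible G (λ v → part v ≡ a)
valid⇒partition G (col , valid) = proj₁ ∘ col , λ a → proj₂ ∘ col , λ u v u∈ v∈ →
  valid u v (λ ()) (λ ()) (trans u∈ (sym v∈))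

theorem5 : (n : ℕ) (G : SimpleGraph n) → TriangleFree G → MaxDegreeAtMost G 3 →
    TwoConnected G → GirthAtMost G 6 →
    Σ (Fin n → Fin 42) λ part → ∀ (a : Fin 42) → Admissible G (λ v → part v ≡ a)
-- A cycle of length 3 would be a triangle.
theorem5 n G triangleFree _ _ (zero , _ , c , _ , adj , close) =
  contradiction close (triangleFree _ _ _ (adj zero) (adj (suc zero)))
-- The cycle has length `4 + r`, so the girth bound 6 leaves `r` at most 2.
theorem5 n G _ deg≤3 (_ , connected , _) (suc r , s≤s (s≤s (s≤s (s≤s r≤2))) , C) =
  valid⇒partition G (Region⇒valid G deg≤3 connected
    (∈-tabulate⁺ {f = proj₁ C} zero) (cycle⇒Region G deg≤3 r r≤2 C))
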